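{- Let $g\ge1$ be an integer and let $a,b$ be integers with $0<a<b$. Define $\gamma_1=a$, $\gamma_2=b$, and for $r\ge3$ let $\gamma_r$ be the smallest integer greater than $\gamma_{r-1}$ such that $\{\gamma_1,\dots,\gamma_r\}$ is a $\mathcal D[g]$ set. Then there is an integer $n_0=n_0(a,b,g)$ such that $\gamma_n=2\gamma_{n-1}$ for all $n\ge n_0$.
   Context: For a positive integer $g$, a set $\mathcal S=\{a_1<a_2<\cdots\}\subset\mathbb N$ is a $\mathcal D[g]$ set if for every $m$ (for which $a_m$ exists) and every $t\in\mathbb Z$, $$\left|\left\{I\subseteq\{1,\dots,m\}:\ \sum_{i\in I}a_i=t\right\}\right|\le g.$$ -}

module Defs where

open import Data.Bool.Base using (if_then_else_)
open import Data.Fin.Base using (toℕ; zero; suc)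
open import Data.Fin.Subset using (Subset; inside; outside)
open import Data.Integer.Base as ℤ using (ℤ; +_)
import Data.Integer.Properties as ℤ
open import Data.List.Base as List using (List; length; filter)
open import Data.List.Membership.Propositional using (_∈_)
open import Data.List.Membership.Propositional.Properties
  using (∈-map⁺; ∈-map⁻; ∈-++⁺ˡ; ∈-++⁺ʳ)
import Data.List.Properties as List
open import Data.List.Relation.Unary.All as ListAll using ()
open import Data.List.Relation.Unary.Any using (here; there)
open import Data.List.Relation.Unary.All.Properties using (all-filter)
open import Data.List.Relation.Unary.Unique.Propositional using (Unique; []; _∷_)
import Data.List.Relation.Unary.Unique.Propositional.Properties as Unique
open import Data.Nat.Base
open import Data.Nat.Properties
open import Algebra.Properties.CommutativeSemigroup +-commutativeSemigroup
  using (interchange)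
open import Data.Product.Base using (∃; ∃-syntax; _×_; _,_; proj₁; proj₂)
open import Data.Sum.Base using (_⊎_; inj₁; inj₂)
open import Data.Vec.Base as Vec
  using (Vec; []; _∷_; _∷ʳ_; truncate; tabulate; zipWith; last)
open import Data.Vec.Properties
  using (∷-injectiveʳ; truncate-refl; truncate-irrelevant; last-∷ʳ)
open import Data.Vec.Relation.Unary.All as All using (All; []; _∷_)
open import Data.Vec.Relation.Unary.AllPairs as AllPairs using (AllPairs; []; _∷_)
open import Function.Base using (_∘_)
open import Relation.Binary.PropositionalEquality
open import Relation.Nullary using (¬_; Dec; yes; no; contradiction)
open import Relation.Nullary.Decidable as Dec using (_×-dec_)
open import Relation.Unary using (Decidable)

private
  variable
    m n : ℕ

subsets : ∀ n → List (Subset n)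
subsets zero    = [] List.∷ List.[]
subsets (suc n) =
  List.map (outside ∷_) (subsets n) List.++ List.map (inside ∷_) (subsets n)

subsetSum : Vec ℕ n → Subset n → ℕ
subsetSum a I = Vec.sum (zipWith (λ s x → if s then x else 0) I a)

representations : Vec ℕ n → ℤ → List (Subset n)
representations {n} a t = filter (λ I → + subsetSum a I ℤ.≟ t) (subsets n)

-- The finite set {a₁ < ⋯ < aᵣ} is given by its increasing enumeration.
IsD : (g : ℕ) {r : ℕ} → Vec ℕ r → Set
IsD g {r} a =
  AllPairs _<_ a ×
  (∀ m (m≤r : m ≤ r) (t : ℤ) → length (representations (truncate m≤r a) t) ≤ g)

-- Sequences are indexed from 1: the value γ 0 is never used.
initial : (ℕ → ℕ) → (n : ℕ) → Vec ℕ n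
initial γ n = tabulate (λ i → γ (suc (toℕ i)))

Admissible : (g : ℕ) → (ℕ → ℕ) → ℕ → ℕ → Set
Admissible g γ n c = γ n < c × IsD g (initial γ n ∷ʳ c)

IsLeast : (ℕ → Set) → ℕ → Set
IsLeast P c = P c × (∀ c′ → P c′ → c ≤ c′)

record IsGreedy (g a b : ℕ) (γ : ℕ → ℕ) : Set where
  field
    first  : γ 1 ≡ a
    second : γ 2 ≡ b
    next   : ∀ r → 3 ≤ r → IsLeast (Admissible g γ (pred r)) (γ r)

-- `subsets n` lists every subset exactly once, so lengths of filtered
-- sublists are cardinalities.

subsets-complete : (I : Subset n) → I ∈ subsets n
subsets-complete []            = here refl
subsets-complete (outside ∷ I) = ∈-++⁺ˡ (∈-map⁺ _ (subsets-complete I))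
subsets-complete (inside  ∷ I) = ∈-++⁺ʳ _ (∈-map⁺ _ (subsets-complete I))

subsets-unique : ∀ n → Unique (subsets n)
subsets-unique zero    = ListAll.[] ∷ []
subsets-unique (suc n) =
  Unique.++⁺ (Unique.map⁺ ∷-injectiveʳ (subsets-unique n))
             (Unique.map⁺ ∷-injectiveʳ (subsets-unique n))
             λ (p , q) → disjoint (∈-map⁻ _ p) (∈-map⁻ _ q)
  where
  disjoint : ∀ {K} → ∃ (λ I → I ∈ subsets n × K ≡ outside ∷ I) →
             ¬ ∃ (λ J → J ∈ subsets n × K ≡ inside ∷ J)
  disjoint (_ , _ , refl) (_ , _ , ())

-- The rest shows that the greedy sequence exists: the sum of all earlier
-- terms plus one is always admissible, and being a 𝒟[g] set is decidable.

#reps : Vec ℕ n → ℤ → ℕ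
#reps a t = length (representations a t)

private
  length-filter-map : ∀ {A B : Set} {P : B → Set} {Q : A → Set}
    (P? : Decidable P) (Q? : Decidable Q) (f : A → B) →
    (∀ x → P (f x) → Q x) → (∀ x → Q x → P (f x)) → ∀ xs →
    length (filter P? (List.map f xs)) ≡ length (filter Q? xs)
  length-filter-map P? Q? f to from List.[] = refl
  length-filter-map P? Q? f to from (x List.∷ xs) with P? (f x) | Q? x
  ... | yes _ | yes _ = cong suc (length-filter-map P? Q? f to from xs)
  ... | no  _ | no  _ = length-filter-map P? Q? f to from xs
  ... | yes p | no ¬q = contradiction (to x p) ¬q
  ... | no ¬p | yes q = contradiction (from x q) ¬p

  +-to : ∀ x s t → + (x + s) ≡ t → + s ≡ t ℤ.- + x
  +-to x s t refl = sym (begin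
    + (x + s) ℤ.- + x       ≡⟨ cong (ℤ._- + x) (cong +_ (+-comm x s)) ⟩
    (+ s ℤ.+ + x) ℤ.- + x   ≡⟨ ℤ.+-assoc (+ s) (+ x) (ℤ.- + x) ⟩
    + s ℤ.+ (+ x ℤ.- + x)   ≡⟨ cong (λ z → + s ℤ.+ z) (ℤ.+-inverseʳ (+ x)) ⟩
    + s ℤ.+ + 0             ≡⟨ ℤ.+-identityʳ (+ s) ⟩
    + s                     ∎)
    where open ≡-Reasoning

  +-from : ∀ x s t → + s ≡ t ℤ.- + x → + (x + s) ≡ t
  +-from x s t eq = begin
    + x ℤ.+ + s             ≡⟨ ℤ.+-comm (+ x) (+ s) ⟩
    + s ℤ.+ + x             ≡⟨ cong (ℤ._+ + x) eq ⟩
    (t ℤ.- + x) ℤ.+ + x     ≡⟨ ℤ.+-assoc t (ℤ.- + x) (+ x) ⟩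
    t ℤ.+ (ℤ.- + x ℤ.+ + x) ≡⟨ cong (λ z → t ℤ.+ z) (ℤ.+-inverseˡ (+ x)) ⟩
    t ℤ.+ + 0               ≡⟨ ℤ.+-identityʳ t ⟩
    t                       ∎
    where open ≡-Reasoning

  swap-- : ∀ t x y → t ℤ.- x ℤ.- y ≡ t ℤ.- y ℤ.- x
  swap-- t x y = begin
    t ℤ.- x ℤ.- y                ≡⟨ ℤ.+-assoc t (ℤ.- x) (ℤ.- y) ⟩
    t ℤ.+ (ℤ.- x ℤ.+ ℤ.- y)      ≡⟨ cong (λ z → t ℤ.+ z) (ℤ.+-comm (ℤ.- x) (ℤ.- y)) ⟩
    t ℤ.+ (ℤ.- y ℤ.+ ℤ.- x)      ≡⟨ ℤ.+-assoc t (ℤ.- y) (ℤ.- x) ⟨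
    t ℤ.- y ℤ.- x                ∎
    where open ≡-Reasoning

#reps-∷ : ∀ x (a : Vec ℕ n) t → #reps (x ∷ a) t ≡ #reps a t + #reps a (t ℤ.- + x)
#reps-∷ {n} x a t = begin
  length (filter P? (xs List.++ ys))
    ≡⟨ cong length (List.filter-++ P? xs ys) ⟩
  length (filter P? xs List.++ filter P? ys)
    ≡⟨ List.length-++ (filter P? xs) ⟩
  length (filter P? xs) + length (filter P? ys)
    ≡⟨ cong₂ _+_
         (length-filter-map P? _ (outside ∷_) (λ _ p → p) (λ _ p → p) (subsets n))
         (length-filter-map P? _ (inside ∷_)
           (λ I → +-to x (subsetSum a I) t) (λ I → +-from x (subsetSum a I) t)
           (subsets n)) ⟩
  #reps a t + #reps a (t ℤ.- + x) ∎
  where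
  open ≡-Reasoning
  P? = λ I → + subsetSum (x ∷ a) I ℤ.≟ t
  xs = List.map (outside ∷_) (subsets n)
  ys = List.map (inside ∷_) (subsets n)

#reps-∷ʳ : ∀ (a : Vec ℕ n) c t → #reps (a ∷ʳ c) t ≡ #reps a t + #reps a (t ℤ.- + c)
#reps-∷ʳ []      c t = #reps-∷ c [] t
#reps-∷ʳ (x ∷ a) c t = begin
  #reps (x ∷ (a ∷ʳ c)) t
    ≡⟨ #reps-∷ x (a ∷ʳ c) t ⟩
  #reps (a ∷ʳ c) t + #reps (a ∷ʳ c) (t ℤ.- + x)
    ≡⟨ cong₂ _+_ (#reps-∷ʳ a c t) (#reps-∷ʳ a c (t ℤ.- + x)) ⟩
  (#reps a t + #reps a (t ℤ.- + c)) + (#reps a (t ℤ.- + x) + #reps a (t ℤ.- + x ℤ.- + c))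
    ≡⟨ interchange (#reps a t) _ _ _ ⟩
  (#reps a t + #reps a (t ℤ.- + x)) + (#reps a (t ℤ.- + c) + #reps a (t ℤ.- + x ℤ.- + c))
    ≡⟨ cong₂ _+_ (sym (#reps-∷ x a t))
         (trans (cong (λ z → #reps a (t ℤ.- + c) + #reps a z) (swap-- t (+ x) (+ c)))
                (sym (#reps-∷ x a (t ℤ.- + c)))) ⟩
  #reps (x ∷ a) t + #reps (x ∷ a) (t ℤ.- + c) ∎
  where open ≡-Reasoning

subsetSum≤sum : (a : Vec ℕ n) (I : Subset n) → subsetSum a I ≤ Vec.sum a
subsetSum≤sum []      []            = z≤n
subsetSum≤sum (x ∷ a) (outside ∷ I) = m≤n⇒m≤o+n x (subsetSum≤sum a I)
subsetSum≤sum (x ∷ a) (inside  ∷ I) = +-monoʳ-≤ x (subsetSum≤sum a I)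

#reps≡0⊎hit : (a : Vec ℕ n) (t : ℤ) → #reps a t ≡ 0 ⊎ ∃[ I ] + subsetSum a I ≡ t
#reps≡0⊎hit {n} a t
  with filter (λ I → + subsetSum a I ℤ.≟ t) (subsets n)
     | all-filter (λ I → + subsetSum a I ℤ.≟ t) (subsets n)
... | List.[]    | _                = inj₁ refl
... | I List.∷ _ | eq ListAll.∷ _   = inj₂ (I , eq)

#reps-disjoint : (a : Vec ℕ n) (c : ℕ) → Vec.sum a < c →
                 ∀ t → #reps a t ≡ 0 ⊎ #reps a (t ℤ.- + c) ≡ 0
#reps-disjoint a c S<c t with #reps≡0⊎hit a t | #reps≡0⊎hit a (t ℤ.- + c)
... | inj₁ z        | _             = inj₁ z
... | inj₂ _        | inj₁ z        = inj₂ z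
... | inj₂ (I , eq) | inj₂ (J , eq′) = contradiction
  (begin-strict
    subsetSum a I      ≤⟨ subsetSum≤sum a I ⟩
    Vec.sum a          <⟨ S<c ⟩
    c                  ≤⟨ m≤m+n c (subsetSum a J) ⟩
    c + subsetSum a J  ≡⟨ ℤ.+-injective (trans (+-from c (subsetSum a J) t eq′) (sym eq)) ⟩
    subsetSum a I      ∎)
  (<-irrefl refl)
  where open ≤-Reasoning

AllPairs-∷ʳ : (a : Vec ℕ n) (c : ℕ) → AllPairs _<_ a → All (_< c) a → AllPairs _<_ (a ∷ʳ c)
AllPairs-∷ʳ []      c []       []       = [] ∷ []
AllPairs-∷ʳ (x ∷ a) c (p ∷ ps) (q ∷ qs) = snoc p ∷ AllPairs-∷ʳ a c ps qs
  where
  snoc : ∀ {k} {v : Vec ℕ k} → All (x <_) v → All (x <_) (v ∷ʳ c)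
  snoc []       = q ∷ []
  snoc (r ∷ rs) = r ∷ snoc rs

sum<⇒All< : (a : Vec ℕ n) (c : ℕ) → Vec.sum a < c → All (_< c) a
sum<⇒All< []      c _   = []
sum<⇒All< (x ∷ a) c S<c =
  ≤-<-trans (m≤m+n x (Vec.sum a)) S<c ∷
  sum<⇒All< a c (≤-<-trans (m≤n+m (Vec.sum a) x) S<c)

truncate-∷ʳ : (m≤n : m ≤ n) (m≤1+n : m ≤ suc n) (a : Vec ℕ n) (c : ℕ) →
              truncate m≤1+n (a ∷ʳ c) ≡ truncate m≤n a
truncate-∷ʳ z≤n       z≤n       a       c = refl
truncate-∷ʳ (s≤s m≤n) (s≤s m≤o) (x ∷ a) c = cong (x ∷_) (truncate-∷ʳ m≤n m≤o a c)

truncate-full : (n≤n : n ≤ n) (a : Vec ℕ n) → truncate n≤n a ≡ a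
truncate-full n≤n a = trans (truncate-irrelevant n≤n ≤-refl a) (truncate-refl a)

IsD-full : ∀ {g} (a : Vec ℕ n) → IsD g a → ∀ t → #reps a t ≤ g
IsD-full {g = g} a (_ , d) t =
  subst (λ v → #reps v t ≤ g) (truncate-refl a) (d _ ≤-refl t)

IsD-∷ʳ : ∀ {g} (a : Vec ℕ n) (c : ℕ) → IsD g a → AllPairs _<_ (a ∷ʳ c) →
         (∀ t → #reps (a ∷ʳ c) t ≤ g) → IsD g (a ∷ʳ c)
IsD-∷ʳ {n} {g} a c (_ , d) inc bound = inc , λ m m≤1+n t → go m m≤1+n t (m≤n⇒m<n∨m≡n m≤1+n)
  where
  go : ∀ m (m≤1+n : m ≤ suc n) t → m < suc n ⊎ m ≡ suc n →
       #reps (truncate m≤1+n (a ∷ʳ c)) t ≤ g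
  go m m≤1+n t (inj₁ (s≤s m≤n)) =
    subst (λ v → #reps v t ≤ g) (sym (truncate-∷ʳ m≤n m≤1+n a c)) (d m m≤n t)
  go m m≤1+n t (inj₂ refl) =
    subst (λ v → #reps v t ≤ g) (sym (truncate-full m≤1+n (a ∷ʳ c))) (bound t)

IsD-[] : ∀ {g} → 1 ≤ g → IsD g []
IsD-[] 1≤g = [] , λ where
  zero z≤n t → ≤-trans (List.length-filter (λ I → + subsetSum [] I ℤ.≟ t) (subsets 0)) 1≤g

sum<⇒IsD : ∀ {g} (a : Vec ℕ n) (c : ℕ) → IsD g a → Vec.sum a < c → IsD g (a ∷ʳ c)
sum<⇒IsD {g = g} a c D S<c =
  IsD-∷ʳ a c D (AllPairs-∷ʳ a c (proj₁ D) (sum<⇒All< a c S<c)) bound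
  where
  bound : ∀ t → #reps (a ∷ʳ c) t ≤ g
  bound t rewrite #reps-∷ʳ a c t with #reps-disjoint a c S<c t
  ... | inj₁ z rewrite z = IsD-full a D (t ℤ.- + c)
  ... | inj₂ z rewrite z | +-identityʳ (#reps a t) = IsD-full a D t

bounded? : ∀ g (a : Vec ℕ n) → Dec (∀ t → #reps a t ≤ g)
bounded? {n} g a =
  Dec.map′ to (λ h → ListAll.tabulate (λ {I} _ → h (+ subsetSum a I)))
           (ListAll.all? (λ I → #reps a (+ subsetSum a I) ≤? g) (subsets n))
  where
  to : ListAll.All (λ I → #reps a (+ subsetSum a I) ≤ g) (subsets n) → ∀ t → #reps a t ≤ g
  to h t with #reps≡0⊎hit a t
  ... | inj₁ z          = ≤-trans (≤-reflexive z) z≤n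
  ... | inj₂ (I , refl) = ListAll.lookup h (subsets-complete I)

IsD-∷ʳ? : ∀ {g} (a : Vec ℕ n) → IsD g a → ∀ c → Dec (IsD g (a ∷ʳ c))
IsD-∷ʳ? {g = g} a D c =
  Dec.map′ (λ (inc , h) → IsD-∷ʳ a c D inc h) (λ E → proj₁ E , IsD-full (a ∷ʳ c) E)
           (AllPairs.allPairs? _<?_ (a ∷ʳ c) ×-dec bounded? g (a ∷ʳ c))

least : {P : ℕ → Set} → Decidable P → ∀ N → P N → ∃ (IsLeast P)
least P? zero    p = zero , p , λ _ _ → z≤n
least {P} P? (suc N) p with P? zero
... | yes p₀ = zero , p₀ , λ _ _ → z≤n
... | no ¬p₀ with least {P ∘ suc} (P? ∘ suc) N p
...   | c , pc , min = suc c , pc , λ where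
  zero     p₀ → contradiction p₀ ¬p₀
  (suc c′) p′ → s≤s (min c′ p′)

last≤sum : (a : Vec ℕ (suc n)) → last a ≤ Vec.sum a
last≤sum (x ∷ [])    = m≤m+n x 0
last≤sum (x ∷ y ∷ a) = ≤-trans (last≤sum (y ∷ a)) (m≤n+m _ x)

initial-∷ʳ : ∀ γ n → initial γ (suc n) ≡ initial γ n ∷ʳ γ (suc n)
initial-∷ʳ γ zero    = refl
initial-∷ʳ γ (suc n) = cong (γ 1 ∷_) (initial-∷ʳ (γ ∘ suc) n)

module _ {g a b : ℕ} (1≤g : 1 ≤ g) (0<a : 0 < a) (a<b : a < b) where

  private
    extension : (v : Vec ℕ (suc n)) → IsD g v →
                ∃ (IsLeast (λ c → last v < c × IsD g (v ∷ʳ c)))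
    extension v D =
      least (λ c → last v <? c ×-dec IsD-∷ʳ? v D c) (suc (Vec.sum v))
            (s≤s (last≤sum v) , sum<⇒IsD v _ D ≤-refl)

    terms : ∀ n → ∃ λ (v : Vec ℕ (2 + n)) → IsD g v
    terms zero    = a ∷ b ∷ [] ,
      sum<⇒IsD (a ∷ []) b (sum<⇒IsD [] a (IsD-[] 1≤g) 0<a)
               (subst (_< b) (sym (+-identityʳ a)) a<b)
    terms (suc n) with terms n
    ... | v , D with extension v D
    ...   | c , (_ , E) , _ = v ∷ʳ c , E

    γ : ℕ → ℕ
    γ zero          = 0
    γ (suc zero)    = a
    γ (suc (suc n)) = last (proj₁ (terms n))

    new : ∀ n → ℕ
    new n = proj₁ (extension (proj₁ (terms n)) (proj₂ (terms n)))

    γ-new : ∀ n → γ (3 + n) ≡ new n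
    γ-new n = last-∷ʳ (new n) (proj₁ (terms n))

    initial-γ : ∀ n → initial γ (2 + n) ≡ proj₁ (terms n)
    initial-γ zero    = refl
    initial-γ (suc n) =
      trans (initial-∷ʳ γ (2 + n)) (cong₂ _∷ʳ_ (initial-γ n) (γ-new n))

    γ-next : ∀ n → IsLeast (Admissible g γ (2 + n)) (γ (3 + n))
    γ-next n =
      subst₂ (λ v c → IsLeast (λ c′ → γ (2 + n) < c′ × IsD g (v ∷ʳ c′)) c)
             (sym (initial-γ n)) (sym (γ-new n))
             (proj₂ (extension (proj₁ (terms n)) (proj₂ (terms n))))

  greedy-exists : ∃[ γ ] IsGreedy g a b γ
  greedy-exists = γ , record
    { first  = refl
    ; second = refl
    ; next   = λ where (suc (suc (suc n))) (s≤s (s≤s (s≤s z≤n))) → γ-next n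
    }

{-# OPTIONS --safe #-}

-- Let r n t (count n t below) be the number of subsets of {γ₁, …, γₙ} with sum t, and
-- let w n = 1 + γ₁ + ⋯ + γₙ (width n).
-- Always γₙ₊₁ ≤ w n and, as r n ≤ g, also 2ⁿ ≤ g w n.  An admissible γₙ₊₂ yields the
-- admissible shift γₙ₊₂ − γₙ₊₁ one step earlier, so by minimality of γₙ₊₁ either
-- γₙ₊₂ ≤ γₙ + γₙ₊₁ or γₙ₊₂ ≥ 2 γₙ₊₁; and γₙ₊₂ ≤ 2 γₙ₊₁ as soon as w n ≤ 2 γₙ₊₁.
-- If n is bad, meaning that γₙ₊₂ ≤ γₙ + γₙ₊₁ or w n > 2 γₙ₊₁, then w n / 2ⁿ drops by at
-- least 1/(8g) within two steps.  It never increases, so bad indices run out of budget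
-- and two consecutive good indices occur before an explicit bound.
--
-- From then on every term doubles: with P the count before and c the value of γ at the
-- first of these, later counts are P(t) + P(t − c) + ⋯ + P(t − (K − 1) c) with K = 2ⁱ,
-- which is c-periodic on [c, K c).  A later γₙ₊₂ ≤ γₙ + γₙ₊₁ would overlap a full period,
-- so its translate modulo c into [3c, 4c) would have been admissible when 4c was chosen.
module Submission where

open import Defs
open import Data.Integer.Base using (+_; -[1+_]; _⊖_)
import Data.Integer.Properties as ℤ
open import Data.Nat.Base
  using (ℕ; zero; suc; _+_; _*_; _∸_; _^_; _≤_; _<_; z≤n; s≤s; NonZero; >-nonZero)
open import Data.Nat.DivMod
  using (_/_; _%_; m%n<n; m≡m%n+[m/n]*n; [m+n]%n≡m%n; [m+kn]%n≡m%n; m%n%n≡m%n; m<n⇒m%n≡m)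
open import Data.Nat.Properties
open import Data.Nat.Tactic.RingSolver using (solve-∀)
open import Data.Product.Base using (∃-syntax; _×_; _,_; proj₁; proj₂)
open import Data.Sum.Base using (_⊎_; inj₁; inj₂; [_,_]′)
open import Data.Vec.Base using (Vec; []; _∷_; _∷ʳ_)
open import Data.Vec.Relation.Unary.All using (All; []; _∷_)
open import Data.Vec.Relation.Unary.AllPairs using (AllPairs; []; _∷_)
open import Function.Base using (_∘_)
open import Relation.Binary.PropositionalEquality
  using (_≡_; refl; sym; trans; cong; cong₂; subst; subst₂; module ≡-Reasoning)
open import Relation.Nullary using (¬_; yes; no; contradiction)
open import Relation.Nullary.Decidable using (decidable-stable)

-- Translation and finite sums of functions on the natural numbers.

shift : ℕ → (ℕ → ℕ) → ℕ → ℕ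
shift zero    f t       = f t
shift (suc c) f zero    = 0
shift (suc c) f (suc t) = shift c f t

shift-+ : ∀ c f t → shift c f (c + t) ≡ f t
shift-+ zero    f t = refl
shift-+ (suc c) f t = shift-+ c f t

shift-< : ∀ c f {t} → t < c → shift c f t ≡ 0
shift-< (suc c) f {zero}  _         = refl
shift-< (suc c) f {suc t} (s≤s t<c) = shift-< c f t<c

shift-cong : ∀ c {f h} → (∀ t → f t ≡ h t) → ∀ t → shift c f t ≡ shift c h t
shift-cong zero    f≡h t       = f≡h t
shift-cong (suc c) f≡h zero    = refl
shift-cong (suc c) f≡h (suc t) = shift-cong c f≡h t

shift-distrib-+ : ∀ c f h t → shift c (λ u → f u + h u) t ≡ shift c f t + shift c h t
shift-distrib-+ zero    f h t       = refl
shift-distrib-+ (suc c) f h zero    = refl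
shift-distrib-+ (suc c) f h (suc t) = shift-distrib-+ c f h t

shift-shift : ∀ c d f t → shift c (shift d f) t ≡ shift (c + d) f t
shift-shift zero    d f t       = refl
shift-shift (suc c) d f zero    = refl
shift-shift (suc c) d f (suc t) = shift-shift c d f t

data Split (c : ℕ) : ℕ → Set where
  below : ∀ {t} → t < c → Split c t
  above : ∀ t → Split c (c + t)

split : ∀ c t → Split c t
split c t with t <? c
... | yes t<c = below t<c
... | no  t≮c = subst (Split c) (m+[n∸m]≡n (≮⇒≥ t≮c)) (above (t ∸ c))

sumBelow : ℕ → (ℕ → ℕ) → ℕ
sumBelow zero    f = 0
sumBelow (suc M) f = f 0 + sumBelow M (f ∘ suc)

sumBelow-≤ : ∀ M {f g} → (∀ t → f t ≤ g) → sumBelow M f ≤ g * M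
sumBelow-≤ zero        f≤g = z≤n
sumBelow-≤ (suc M) {f} {g} f≤g =
  ≤-trans (+-mono-≤ (f≤g 0) (sumBelow-≤ M (f≤g ∘ suc))) (≤-reflexive (sym (*-suc g M)))

sumBelow-+ : ∀ M f h → sumBelow M (λ t → f t + h t) ≡ sumBelow M f + sumBelow M h
sumBelow-+ zero    f h = refl
sumBelow-+ (suc M) f h =
  trans (cong (λ z → f 0 + h 0 + z) (sumBelow-+ M (f ∘ suc) (h ∘ suc)))
        (lemma (f 0) (h 0) _ _)
  where
  lemma : ∀ x y z w → x + y + (z + w) ≡ x + z + (y + w)
  lemma = solve-∀

sumBelow-shift : ∀ c M f → sumBelow (c + M) (shift c f) ≡ sumBelow M f
sumBelow-shift zero    M f = refl
sumBelow-shift (suc c) M f = sumBelow-shift c M f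

sumBelow-zero : ∀ M f → (∀ t → f t ≡ 0) → sumBelow M f ≡ 0
sumBelow-zero zero    f z = refl
sumBelow-zero (suc M) f z = cong₂ _+_ (z 0) (sumBelow-zero M (f ∘ suc) (z ∘ suc))

sumBelow-support : ∀ M c f → (∀ t → f (M + t) ≡ 0) → sumBelow (M + c) f ≡ sumBelow M f
sumBelow-support zero    c f z = sumBelow-zero c f z
sumBelow-support (suc M) c f z = cong (λ y → f 0 + y) (sumBelow-support M c (f ∘ suc) z)

2*c+t≡c+[c+t] : ∀ c t → 2 * c + t ≡ c + (c + t)
2*c+t≡c+[c+t] = solve-∀

-- Subset-sum counts of the initial segments.

module Counts (γ : ℕ → ℕ) where

  -- The coefficient of `x ^ t` in the product of the factors `1 + x ^ γ i` for 1 ≤ i ≤ n;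
  -- `#reps-initial` identifies it with the number of representations.
  count : ℕ → ℕ → ℕ
  count zero    zero    = 1
  count zero    (suc t) = 0
  count (suc n) t       = count n t + shift (γ (suc n)) (count n) t

  width : ℕ → ℕ
  width zero    = 1
  width (suc n) = width n + γ (suc n)

  count-width : ∀ n t → count n (width n + t) ≡ 0
  count-width zero    t = refl
  count-width (suc n) t = cong₂ _+_
    (trans (cong (count n) (+-assoc (width n) _ t)) (count-width n _))
    (trans (cong (shift (γ (suc n)) (count n)) (lemma (width n) (γ (suc n)) t))
      (trans (shift-+ (γ (suc n)) (count n) _) (count-width n t)))
    where
    lemma : ∀ w c u → w + c + u ≡ c + (w + u)
    lemma = solve-∀

  count-≥width : ∀ n {t} → width n ≤ t → count n t ≡ 0
  count-≥width n {t} w≤t =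
    trans (cong (count n) (sym (m+[n∸m]≡n w≤t))) (count-width n _)

  count-2*width : ∀ n c → width n ≤ 2 * c → ∀ t → count n (c + (c + t)) ≡ 0
  count-2*width n c w≤2c t = count-≥width n
    (≤-trans w≤2c (subst (2 * c ≤_) (2*c+t≡c+[c+t] c t) (m≤m+n (2 * c) t)))

  -- Each of the `2 ^ n` subsets has its sum below `width n`. Passing to `suc n` adds a translated
  -- copy with the same total.
  count-total : ∀ n → sumBelow (width n) (count n) ≡ 2 ^ n
  count-total zero    = refl
  count-total (suc n) = begin
    sumBelow (w + c) (count (suc n))
      ≡⟨ sumBelow-+ (w + c) (count n) (shift c (count n)) ⟩
    sumBelow (w + c) (count n) + sumBelow (w + c) (shift c (count n))
      ≡⟨ cong₂ _+_ (sumBelow-support w c (count n) (count-width n))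
           (trans (cong (λ v → sumBelow v (shift c (count n))) (+-comm w c))
                  (sumBelow-shift c w (count n))) ⟩
    sumBelow w (count n) + sumBelow w (count n)
      ≡⟨ cong₂ _+_ (count-total n) (count-total n) ⟩
    2 ^ n + 2 ^ n
      ≡⟨ cong (λ z → 2 ^ n + z) (+-identityʳ (2 ^ n)) ⟨
    2 ^ suc n ∎
    where
    open ≡-Reasoning
    w = width n
    c = γ (suc n)

  count-step : ∀ n t → count (suc n) (γ (suc n) + t) ≡ count n (γ (suc n) + t) + count n t
  count-step n t = cong (λ z → count n (γ (suc n) + t) + z) (shift-+ (γ (suc n)) (count n) t)

-- Agreement of the counts with the numbers of representations.

#reps-neg : ∀ {n} (v : Vec ℕ n) k → #reps v -[1+ k ] ≡ 0
#reps-neg v k with #reps≡0⊎hit v -[1+ k ]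
... | inj₁ z = z

#reps-⊖ : ∀ {n} (v : Vec ℕ n) c t → #reps v (t ⊖ c) ≡ shift c (λ u → #reps v (+ u)) t
#reps-⊖ v zero    t       = refl
#reps-⊖ v (suc c) zero    = #reps-neg v c
#reps-⊖ v (suc c) (suc t) =
  trans (cong (#reps v) (ℤ.[1+m]⊖[1+n]≡m⊖n t c)) (#reps-⊖ v c t)

#reps-snoc : ∀ {n} (v : Vec ℕ n) c t →
             #reps (v ∷ʳ c) (+ t) ≡ #reps v (+ t) + shift c (λ u → #reps v (+ u)) t
#reps-snoc v c t = trans (#reps-∷ʳ v c (+ t))
  (cong (λ z → #reps v (+ t) + z) (trans (cong (#reps v) (ℤ.m-n≡m⊖n t c)) (#reps-⊖ v c t)))

#reps-initial : ∀ γ n t → #reps (initial γ n) (+ t) ≡ Counts.count γ n t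
#reps-initial γ zero    zero    = refl
#reps-initial γ zero    (suc t) = refl
#reps-initial γ (suc n) t = begin
  #reps (initial γ (suc n)) (+ t)
    ≡⟨ cong (λ v → #reps v (+ t)) (initial-∷ʳ γ n) ⟩
  #reps (initial γ n ∷ʳ γ (suc n)) (+ t)
    ≡⟨ #reps-snoc (initial γ n) (γ (suc n)) t ⟩
  #reps (initial γ n) (+ t) + shift (γ (suc n)) (λ u → #reps (initial γ n) (+ u)) t
    ≡⟨ cong₂ _+_ (#reps-initial γ n t) (shift-cong (γ (suc n)) (#reps-initial γ n) t) ⟩
  Counts.count γ (suc n) t ∎
  where open ≡-Reasoning

All-∷ʳ⁻ : ∀ {P : ℕ → Set} {n} (v : Vec ℕ n) {c} → All P (v ∷ʳ c) → P c
All-∷ʳ⁻ []      (p ∷ []) = p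
All-∷ʳ⁻ (x ∷ v) (_ ∷ ps) = All-∷ʳ⁻ v ps

AllPairs-∷ʳ⇒All< : ∀ {n} (v : Vec ℕ n) {c s} →
                   AllPairs _<_ (v ∷ʳ c) → c < s → All (_< s) (v ∷ʳ c)
AllPairs-∷ʳ⇒All< []      _        c<s = c<s ∷ []
AllPairs-∷ʳ⇒All< (x ∷ v) (p ∷ ps) c<s =
  <-trans (All-∷ʳ⁻ v p) c<s ∷ AllPairs-∷ʳ⇒All< v ps c<s

-- Sums of translates and their periodization.

module Periodization (P : ℕ → ℕ) (c : ℕ) .{{_ : NonZero c}}
                     (support : ∀ t → P (c + (c + t)) ≡ 0) where

  comb : ℕ → ℕ → ℕ
  comb zero    t = 0
  comb (suc K) t = P t + shift c (comb K) t

  comb-+ : ∀ K L t → comb (K + L) t ≡ comb K t + shift (K * c) (comb L) t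
  comb-+ zero    L t = refl
  comb-+ (suc K) L t = begin
    P t + shift c (comb (K + L)) t
      ≡⟨ cong (λ z → P t + z) (shift-cong c (comb-+ K L) t) ⟩
    P t + shift c (λ u → comb K u + shift (K * c) (comb L) u) t
      ≡⟨ cong (λ z → P t + z) (shift-distrib-+ c (comb K) _ t) ⟩
    P t + (shift c (comb K) t + shift c (shift (K * c) (comb L)) t)
      ≡⟨ cong (λ z → P t + (shift c (comb K) t + z)) (shift-shift c (K * c) (comb L) t) ⟩
    P t + (shift c (comb K) t + shift (c + K * c) (comb L) t)
      ≡⟨ +-assoc (P t) _ _ ⟨
    comb (suc K) t + shift (suc K * c) (comb L) t ∎
    where open ≡-Reasoning

  comb-+ᶜ : ∀ K t → comb (suc K) (c + t) ≡ P (c + t) + comb K t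
  comb-+ᶜ K t = cong (λ z → P (c + t) + z) (shift-+ c (comb K) t)

  comb-< : ∀ K {t} → t < c → comb (suc K) t ≡ P t
  comb-< K {t} t<c = trans (cong (λ z → P t + z) (shift-< c (comb K) t<c)) (+-identityʳ (P t))

  -- The sum of `P` over the residue class of `t` modulo `c`: as `P` vanishes from `2 * c` on, only
  -- two values survive.
  wrap : ℕ → ℕ
  wrap t = P (t % c) + P (c + t % c)

  wrap-cong : ∀ t u → t % c ≡ u % c → wrap t ≡ wrap u
  wrap-cong _ _ = cong (λ r → P r + P (c + r))

  wrap-+ : ∀ t → wrap (c + t) ≡ wrap t
  wrap-+ t = wrap-cong (c + t) t (trans (cong (_% c) (+-comm c t)) ([m+n]%n≡m%n t c))

  wrap-< : ∀ {t} → t < c → wrap t ≡ P t + P (c + t)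
  wrap-< t<c = cong (λ r → P r + P (c + r)) (m<n⇒m%n≡m t<c)

  comb-≤-P : ∀ K {t} → t < c → comb K t ≤ P t
  comb-≤-P zero    t<c = z≤n
  comb-≤-P (suc K) t<c = ≤-reflexive (comb-< K t<c)

  -- `comb K t` collects only part of the sum over the residue class of `t`.
  comb≤wrap : ∀ K t → comb K t ≤ wrap t
  comb≤wrap zero    t = z≤n
  comb≤wrap (suc K) t with split c t
  ... | below t<c = subst₂ _≤_ (sym (comb-< K t<c)) (sym (wrap-< t<c)) (m≤m+n _ _)
  ... | above u   = subst₂ _≤_ (sym (comb-+ᶜ K u)) (sym (wrap-+ u)) (head u)
    where
    head : ∀ u → P (c + u) + comb K u ≤ wrap u
    head u with split c u
    ... | below u<c = subst (P (c + u) + comb K u ≤_) (trans (+-comm (P (c + u)) (P u)) (sym (wrap-< u<c)))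
                        (+-monoʳ-≤ (P (c + u)) (comb-≤-P K u<c))
    -- From `2 * c` on the untranslated copy of `P` contributes nothing, and the claim passes to `K`
    -- with the argument lowered by `c`.
    ... | above w   = subst (λ z → z + comb K (c + w) ≤ wrap (c + w)) (sym (support w))
                        (comb≤wrap K (c + w))

  -- Write `c + u` as q c + r with r < c. The two values in `wrap` come from the translates by q c
  -- and (q - 1) c, and both occur in `comb (suc K)` because 1 ≤ q ≤ K.
  wrap≤comb-+ᶜ : ∀ K u → u < K * c → wrap (c + u) ≤ comb (suc K) (c + u)
  wrap≤comb-+ᶜ (suc K) u u<Kc with split c u
  ... | below u<c = ≤-reflexive (begin
    wrap (c + u)                   ≡⟨ wrap-+ u ⟩
    wrap u                         ≡⟨ wrap-< u<c ⟩
    P u + P (c + u)                ≡⟨ +-comm (P u) _ ⟩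
    P (c + u) + P u                ≡⟨ cong (λ z → P (c + u) + z) (comb-< K u<c) ⟨
    P (c + u) + comb (suc K) u     ≡⟨ comb-+ᶜ (suc K) u ⟨
    comb (suc (suc K)) (c + u)     ∎)
    where open ≡-Reasoning
  ... | above w   = begin
    wrap (c + (c + w))                         ≡⟨ wrap-+ (c + w) ⟩
    wrap (c + w)                               ≤⟨ wrap≤comb-+ᶜ K w (+-cancelˡ-< c w (K * c) u<Kc) ⟩
    comb (suc K) (c + w)                       ≤⟨ m≤n+m (comb (suc K) (c + w)) (P (c + (c + w))) ⟩
    P (c + (c + w)) + comb (suc K) (c + w)     ≡⟨ comb-+ᶜ (suc K) (c + w) ⟨
    comb (suc (suc K)) (c + (c + w))           ∎
    where open ≤-Reasoning

  wrap≤comb : ∀ K {t} → c ≤ t → t < K * c → wrap t ≤ comb K t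
  wrap≤comb (suc K) {t} c≤t t<Kc with split c t
  ... | below t<c = contradiction t<c (≤⇒≯ c≤t)
  ... | above u   = wrap≤comb-+ᶜ K u (+-cancelˡ-< c u (K * c) t<Kc)

  -- The representative of s modulo c in [3c, 4c).
  reduced : ℕ → ℕ
  reduced s = s % c + 3 * c

  -- `reduced s` and `t % c + c` differ from `s` and `t` by multiples of `c`.
  %-shift-reduced : ∀ s t → (reduced s + t) % c ≡ (s + (t % c + c)) % c
  %-shift-reduced s t = begin
    (s % c + 3 * c + t) % c
      ≡⟨ cong (λ z → (s % c + 3 * c + z) % c) (m≡m%n+[m/n]*n t c) ⟩
    (s % c + 3 * c + (t % c + t / c * c)) % c
      ≡⟨ cong (_% c) (reassoc (s % c) (t % c) (t / c) c) ⟩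
    (s % c + t % c + (3 + t / c) * c) % c
      ≡⟨ [m+kn]%n≡m%n (s % c + t % c) (3 + t / c) c ⟩
    (s % c + t % c) % c
      ≡⟨ [m+kn]%n≡m%n (s % c + t % c) (1 + s / c) c ⟨
    (s % c + t % c + (1 + s / c) * c) % c
      ≡⟨ cong (_% c) (reassoc′ (s % c) (s / c) (t % c) c) ⟨
    (s % c + s / c * c + (t % c + c)) % c
      ≡⟨ cong (λ z → (z + (t % c + c)) % c) (m≡m%n+[m/n]*n s c) ⟨
    (s + (t % c + c)) % c ∎
    where
    open ≡-Reasoning
    reassoc : ∀ x y q c → x + 3 * c + (y + q * c) ≡ x + y + (3 + q) * c
    reassoc = solve-∀
    reassoc′ : ∀ x p y c → x + p * c + (y + c) ≡ x + y + (1 + p) * c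
    reassoc′ = solve-∀

  -- The overlap of comb K with its shift by s contains a full period of both.
  comb-reduced : ∀ K L {g s} → (∀ t → comb K (s + t) + comb K t ≤ g) →
                 s + 2 * c ≤ K * c → ∀ t → comb L (reduced s + t) + comb L t ≤ g
  comb-reduced K L {g} {s} fits s≤ t = begin
    comb L (reduced s + t) + comb L t
      ≤⟨ +-mono-≤ (comb≤wrap L (reduced s + t)) (comb≤wrap L t) ⟩
    wrap (reduced s + t) + wrap t
      ≡⟨ cong₂ _+_ (wrap-cong (reduced s + t) (s + T) (%-shift-reduced s t)) (wrap-cong t T t≡) ⟩
    wrap (s + T) + wrap T
      ≤⟨ +-mono-≤ (wrap≤comb K (m≤n⇒m≤o+n s c≤T) s+T<) (wrap≤comb K c≤T (≤-<-trans (m≤n+m T s) s+T<)) ⟩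
    comb K (s + T) + comb K T
      ≤⟨ fits T ⟩
    g ∎
    where
    open ≤-Reasoning
    -- The representative of `t` in [c, 2c): both `T` and `s + T` then lie in [c, K c), where
    -- `wrap≤comb` applies.
    T = t % c + c
    c≤T : c ≤ T
    c≤T = m≤n+m c (t % c)
    s+T< : s + T < K * c
    s+T< = <-≤-trans (+-monoʳ-< s (subst (T <_) (cong (λ z → c + z) (sym (+-identityʳ c)))
             (+-monoˡ-< c (m%n<n t c)))) s≤
    t≡ : t % c ≡ T % c
    t≡ = sym (trans ([m+n]%n≡m%n (t % c) c) (m%n%n≡m%n t c))

-- The greedy conditions in terms of counts.

module Greedy {g a b : ℕ} (1≤g : 1 ≤ g) (0<a : 0 < a) (a<b : a < b)
              {γ : ℕ → ℕ} (greedy : IsGreedy g a b γ) where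

  open IsGreedy greedy
  open Counts γ

  -- The left side is the count at `s + t` once `s` is appended. Below `s` appending changes no
  -- count, so nothing is asked there.
  Fits : ℕ → ℕ → Set
  Fits n s = ∀ t → count n (s + t) + count n t ≤ g

  initial-IsD : ∀ n → IsD g (initial γ (2 + n))
  initial-IsD zero rewrite first | second =
    sum<⇒IsD (a ∷ []) b (sum<⇒IsD [] a (IsD-[] 1≤g) 0<a)
             (subst (_< b) (sym (+-identityʳ a)) a<b)
  initial-IsD (suc n) = subst (IsD g) (sym (initial-∷ʳ γ (2 + n)))
    (proj₂ (proj₁ (next (3 + n) (s≤s (s≤s (s≤s z≤n))))))

  count≤g : ∀ n t → count (2 + n) t ≤ g
  count≤g n t = subst (_≤ g) (#reps-initial γ (2 + n) t)
    (IsD-full (initial γ (2 + n)) (initial-IsD n) (+ t))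

  γ-< : ∀ n → γ (2 + n) < γ (3 + n)
  γ-< n = proj₁ (proj₁ (next (3 + n) (s≤s (s≤s (s≤s z≤n)))))

  γ-fits : ∀ n → Fits (2 + n) (γ (3 + n))
  γ-fits n t = subst (_≤ g) (count-step (2 + n) t) (count≤g (suc n) (γ (3 + n) + t))

  -- Every later use of minimality goes through this form.
  γ-least : ∀ n {s} → γ (2 + n) < s → Fits (2 + n) s → γ (3 + n) ≤ s
  γ-least n {s} γ<s fits =
    proj₂ (next (3 + n) (s≤s (s≤s (s≤s z≤n)))) s (γ<s , IsD-∷ʳ v s (initial-IsD n) increasing bound)
    where
    v = initial γ (2 + n)
    increasing : AllPairs _<_ (v ∷ʳ s)
    increasing = AllPairs-∷ʳ v s (proj₁ (initial-IsD n))
      (subst (All (_< s)) (sym (initial-∷ʳ γ (1 + n)))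
        (AllPairs-∷ʳ⇒All< (initial γ (1 + n))
          (subst (AllPairs _<_) (initial-∷ʳ γ (1 + n)) (proj₁ (initial-IsD n))) γ<s))
    bound⁺ : ∀ t → count (2 + n) t + shift s (count (2 + n)) t ≤ g
    bound⁺ t with split s t
    ... | below t<s = subst (_≤ g)
      (sym (trans (cong (λ z → count (2 + n) t + z) (shift-< s (count (2 + n)) t<s)) (+-identityʳ _)))
      (count≤g n t)
    ... | above u   = subst (_≤ g)
      (sym (cong (λ z → count (2 + n) (s + u) + z) (shift-+ s (count (2 + n)) u)))
      (fits u)
    bound : ∀ t → #reps (v ∷ʳ s) t ≤ g
    bound (+ t)    = subst (_≤ g)
      (sym (trans (#reps-snoc v s t)
        (cong₂ _+_ (#reps-initial γ (2 + n) t) (shift-cong s (#reps-initial γ (2 + n)) t))))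
      (bound⁺ t)
    bound -[1+ k ] = subst (_≤ g) (sym (#reps-neg (v ∷ʳ s) k)) z≤n

  width-pos : ∀ n → 1 ≤ width n
  width-pos zero    = ≤-refl
  width-pos (suc n) = ≤-trans (width-pos n) (m≤m+n _ _)

  γ<width : ∀ n → γ (suc n) < width (suc n)
  γ<width n = +-monoˡ-≤ (γ (suc n)) (width-pos n)

  -- The translate by `width (2 + n)` misses the support of the count, so no count grows.
  γ≤width : ∀ n → γ (3 + n) ≤ width (2 + n)
  γ≤width n = γ-least n (γ<width (suc n)) λ t →
    subst (λ z → z + count (2 + n) t ≤ g) (sym (count-width (2 + n) t)) (count≤g n t)

  -- Pigeonhole: all subset sums lie below the width, and each value is taken at most `g` times.
  2^≤g*width : ∀ n → 2 ^ (2 + n) ≤ g * width (2 + n)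
  2^≤g*width n = subst (_≤ g * width (2 + n)) (count-total (2 + n))
    (sumBelow-≤ (width (2 + n)) (count≤g n))

  -- Adding `γ (suc n)` to a subset with sum `s + t` gives one with sum `γ (suc n) + s + t`, so both
  -- counts on the left are bounded by counts at level `suc n`.
  fits-descend : ∀ n s → Fits (suc n) (γ (suc n) + s) → Fits n s
  fits-descend n s fits t = begin
    count n (s + t) + count n t
      ≤⟨ +-mono-≤ (m≤n+m _ (count n (c + (s + t)))) (m≤m+n _ _) ⟩
    (count n (c + (s + t)) + count n (s + t)) + count (suc n) t
      ≡⟨ cong (λ z → z + count (suc n) t) (count-step n (s + t)) ⟨
    count (suc n) (c + (s + t)) + count (suc n) t
      ≡⟨ cong (λ z → count (suc n) z + count (suc n) t) (+-assoc c s t) ⟨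
    count (suc n) (c + s + t) + count (suc n) t
      ≤⟨ fits t ⟩
    g ∎
    where
    open ≤-Reasoning
    c = γ (suc n)

  -- Conditions under which a term doubles.

  Leaps : ℕ → Set
  Leaps n = γ n + γ (suc n) < γ (2 + n)

  -- The difference of the last two terms competes with `γ (3 + n)`: it fits by `fits-descend`, and
  -- the leap says exactly that it exceeds `γ (2 + n)`.
  leaps⇒≥2* : ∀ n → Leaps (2 + n) → 2 * γ (3 + n) ≤ γ (4 + n)
  leaps⇒≥2* n leaps = begin
    2 * c   ≡⟨ cong (λ z → c + z) (+-identityʳ c) ⟩
    c + c   ≤⟨ +-monoʳ-≤ c (γ-least n γ<s (fits-descend (2 + n) s
                 (subst (Fits (3 + n)) (sym c+s≡) (γ-fits (suc n))))) ⟩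
    c + s   ≡⟨ c+s≡ ⟩
    γ (4 + n) ∎
    where
    open ≤-Reasoning
    c = γ (3 + n)
    s = γ (4 + n) ∸ c
    c+s≡ : c + s ≡ γ (4 + n)
    c+s≡ = m+[n∸m]≡n (<⇒≤ (γ-< (suc n)))
    γ<s : γ (2 + n) < s
    γ<s = +-cancelˡ-< c _ _ (subst₂ _<_ (+-comm (γ (2 + n)) c) (sym c+s≡) leaps)

  -- The candidate `2 * c` fits: as `f` vanishes from `2 * c` on, `count (3 + n)` at `2 * c + t` is
  -- just `f (c + t)`. For `t < c` the resulting sum is already bounded because `c` fitted; for
  -- larger `t` this term is zero.
  width≤⇒≤2* : ∀ n → width (2 + n) ≤ 2 * γ (3 + n) → γ (4 + n) ≤ 2 * γ (3 + n)
  width≤⇒≤2* n w≤2c = γ-least (suc n) c<2c fits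
    where
    c = γ (3 + n)
    f = count (2 + n)
    0<c : 0 < c
    0<c = ≤-<-trans z≤n (γ-< n)
    c<2c : c < 2 * c
    c<2c = subst (c <_) (cong (λ z → c + z) (sym (+-identityʳ c))) (m<m+n c 0<c)
    count-2c : ∀ t → count (3 + n) (2 * c + t) ≡ f (c + t)
    count-2c t = begin
      count (3 + n) (2 * c + t)               ≡⟨ cong (count (3 + n)) (2*c+t≡c+[c+t] c t) ⟩
      count (3 + n) (c + (c + t))             ≡⟨ count-step (2 + n) (c + t) ⟩
      f (c + (c + t)) + f (c + t)             ≡⟨ cong (λ z → z + f (c + t)) (count-2*width (2 + n) c w≤2c t) ⟩
      f (c + t)                               ∎
      where
      open ≡-Reasoning
    fits : Fits (3 + n) (2 * c)
    fits t rewrite count-2c t with split c t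
    ... | below t<c = subst (λ z → f (c + t) + z ≤ g)
      (sym (trans (cong (λ z → f t + z) (shift-< c f t<c)) (+-identityʳ _)))
      (γ-fits n t)
    ... | above u   = subst (λ z → z + count (3 + n) (c + u) ≤ g)
      (sym (count-2*width (2 + n) c w≤2c u)) (count≤g (suc n) (c + u))

  -- Good and bad indices, and the potential 8 g w n / 2ⁿ.

  Good : ℕ → Set
  Good n = width n ≤ 2 * γ (suc n) × Leaps n

  good⇒doubles : ∀ n → Good (2 + n) → γ (4 + n) ≡ 2 * γ (3 + n)
  good⇒doubles n (w≤2c , leaps) = ≤-antisym (width≤⇒≤2* n w≤2c) (leaps⇒≥2* n leaps)

  Bad : ℕ → Set
  Bad n = 2 * γ (suc n) < width n ⊎ γ (2 + n) ≤ γ n + γ (suc n)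

  good? : ∀ n → Good n ⊎ Bad n
  good? n with width n ≤? 2 * γ (suc n) | γ n + γ (suc n) <? γ (2 + n)
  ... | yes p | yes q = inj₁ (p , q)
  ... | yes _ | no ¬q = inj₂ (inj₂ (≮⇒≥ ¬q))
  ... | no ¬p | _     = inj₂ (inj₁ (≰⇒> ¬p))

  -- `x` measures how far the width stays below quadrupling in two steps. The factor 8 is what the
  -- second case needs, where `x` is a width three indices back.
  deficit : ∀ n → Bad (3 + n) →
            ∃[ x ] (width (5 + n) + x ≤ 4 * width (3 + n) × 2 ^ (5 + n) ≤ 8 * g * x)
  deficit n (inj₁ 2c<w) = w , fall , (begin
    2 ^ (5 + n)       ≡⟨ lemma₁ (2 ^ (3 + n)) ⟩
    4 * 2 ^ (3 + n)   ≤⟨ *-mono-≤ {4} {8} (m≤m+n 4 4) (2^≤g*width (suc n)) ⟩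
    8 * (g * w)       ≡⟨ *-assoc 8 g w ⟨
    8 * g * w         ∎)
    where
    open ≤-Reasoning
    w = width (3 + n)
    c = γ (4 + n)
    lemma₁ : ∀ p → 2 * (2 * p) ≡ 4 * p
    lemma₁ = solve-∀
    lemma₂ : ∀ w c → w + c + (w + c) + w ≡ 3 * w + 2 * c
    lemma₂ = solve-∀
    lemma₃ : ∀ w → 3 * w + w ≡ 4 * w
    lemma₃ = solve-∀
    fall : width (5 + n) + w ≤ 4 * w
    fall = begin
      w + c + γ (5 + n) + w     ≤⟨ +-monoˡ-≤ w (+-monoʳ-≤ (w + c) (γ≤width (2 + n))) ⟩
      w + c + (w + c) + w       ≡⟨ lemma₂ w c ⟩
      3 * w + 2 * c             ≤⟨ +-monoʳ-≤ (3 * w) (<⇒≤ 2c<w) ⟩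
      3 * w + w                 ≡⟨ lemma₃ w ⟩
      4 * w                     ∎
  -- The general bound on `γ (5 + n)` is `v + d + c`; a short step has `d + c` instead, which saves
  -- `v`.
  deficit n (inj₂ short) = v , fall , (begin
    2 ^ (5 + n)       ≡⟨ lemma₁ (2 ^ (2 + n)) ⟩
    8 * 2 ^ (2 + n)   ≤⟨ *-monoʳ-≤ 8 (2^≤g*width n) ⟩
    8 * (g * v)       ≡⟨ *-assoc 8 g v ⟨
    8 * g * v         ∎)
    where
    open ≤-Reasoning
    v = width (2 + n)
    d = γ (3 + n)
    c = γ (4 + n)
    lemma₁ : ∀ p → 2 * (2 * (2 * p)) ≡ 8 * p
    lemma₁ = solve-∀
    lemma₂ : ∀ v d c → v + d + c + (d + c) + v ≡ 2 * (v + d) + 2 * c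
    lemma₂ = solve-∀
    lemma₃ : ∀ w → 2 * w + 2 * w ≡ 4 * w
    lemma₃ = solve-∀
    fall : width (5 + n) + v ≤ 4 * (v + d)
    fall = begin
      v + d + c + γ (5 + n) + v   ≤⟨ +-monoˡ-≤ v (+-monoʳ-≤ (v + d + c) short) ⟩
      v + d + c + (d + c) + v     ≡⟨ lemma₂ v d c ⟩
      2 * (v + d) + 2 * c         ≤⟨ +-monoʳ-≤ (2 * (v + d)) (*-monoʳ-≤ 2 (γ≤width (suc n))) ⟩
      2 * (v + d) + 2 * (v + d)   ≡⟨ lemma₃ (v + d) ⟩
      4 * (v + d)                 ∎

  potential-step : ∀ n k → 8 * g * width (2 + n) ≤ 2 ^ (2 + n) * k →
                   8 * g * width (3 + n) ≤ 2 ^ (3 + n) * k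
  potential-step n k h = begin
    G * (w + γ (3 + n))     ≤⟨ *-monoʳ-≤ G (+-monoʳ-≤ w (γ≤width n)) ⟩
    G * (w + w)             ≡⟨ lemma₁ G w ⟩
    2 * (G * w)             ≤⟨ *-monoʳ-≤ 2 h ⟩
    2 * (2 ^ (2 + n) * k)   ≡⟨ *-assoc 2 (2 ^ (2 + n)) k ⟨
    2 ^ (3 + n) * k         ∎
    where
    open ≤-Reasoning
    G = 8 * g
    w = width (2 + n)
    lemma₁ : ∀ G w → G * (w + w) ≡ 2 * (G * w)
    lemma₁ = solve-∀

  -- `k` bounds the potential. The saving `x` from `deficit` is worth at least one unit, since
  -- `8 * g * x` is at least `2 ^ (5 + n)`.
  potential-drop : ∀ n k → Bad (3 + n) →
    8 * g * width (3 + n) ≤ 2 ^ (3 + n) * suc k →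
    8 * g * width (5 + n) ≤ 2 ^ (5 + n) * k
  potential-drop n k bad h with deficit n bad
  ... | x , fall , 2^≤ = +-cancelʳ-≤ (2 ^ (5 + n)) _ _ (begin
    G * width (5 + n) + 2 ^ (5 + n)   ≤⟨ +-monoʳ-≤ (G * width (5 + n)) 2^≤ ⟩
    G * width (5 + n) + G * x         ≡⟨ *-distribˡ-+ G (width (5 + n)) x ⟨
    G * (width (5 + n) + x)           ≤⟨ *-monoʳ-≤ G fall ⟩
    G * (4 * width (3 + n))           ≡⟨ lemma₁ G (width (3 + n)) ⟩
    4 * (G * width (3 + n))           ≤⟨ *-monoʳ-≤ 4 h ⟩
    4 * (2 ^ (3 + n) * suc k)         ≡⟨ lemma₂ (2 ^ (3 + n)) k ⟩
    2 ^ (5 + n) * k + 2 ^ (5 + n)     ∎)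
    where
    open ≤-Reasoning
    G = 8 * g
    lemma₁ : ∀ G w → G * (4 * w) ≡ 4 * (G * w)
    lemma₁ = solve-∀
    lemma₂ : ∀ p k → 4 * (p * suc k) ≡ 2 * (2 * p) * k + 2 * (2 * p)
    lemma₂ = solve-∀

  -- Induction on the budget `k`. A bad index spends a unit within two steps, a good one followed by
  -- a bad one within three; hence `3 * k`. With no budget left the hypothesis fails, as `g` and the
  -- width are positive.
  good-pair : ∀ k n → 8 * g * width (3 + n) ≤ 2 ^ (3 + n) * k →
              ∃[ m ] (m ≤ n + 3 * k × Good (3 + m) × Good (4 + m))
  good-pair zero n h = contradiction
    (≤-trans (*-mono-≤ {1} {8 * g} {1} {width (3 + n)}
               (*-mono-≤ {1} {8} {1} {g} (s≤s z≤n) 1≤g) (width-pos (3 + n))) h)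
    (subst (λ z → ¬ 1 ≤ z) (sym (*-zeroʳ (2 ^ (3 + n)))) λ ())
  good-pair (suc k) n h = [ first-good , first-bad ]′ (good? (3 + n))
    where
    Result : Set
    Result = ∃[ m ] (m ≤ n + 3 * suc k × Good (3 + m) × Good (4 + m))
    regroup : ∀ n k → 3 + n + 3 * k ≡ n + 3 * suc k
    regroup = solve-∀
    weaken : ∀ d → d ≤ 3 → ∃[ m ] (m ≤ d + n + 3 * k × Good (3 + m) × Good (4 + m)) → Result
    weaken d d≤3 (m , m≤ , goods) = m , ≤-trans m≤
      (≤-trans (+-monoˡ-≤ (3 * k) (+-monoˡ-≤ n d≤3)) (≤-reflexive (regroup n k))) , goods
    first-bad : Bad (3 + n) → Result
    first-bad bad = weaken 2 (s≤s (s≤s z≤n)) (good-pair k (2 + n) (potential-drop n k bad h))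
    first-good : Good (3 + n) → Result
    first-good good = [ (λ good′ → n , m≤m+n n (3 * suc k) , good , good′)
                      , (λ bad → weaken 3 ≤-refl (good-pair k (3 + n)
                          (potential-drop (1 + n) k bad (potential-step (1 + n) (suc k) h))))
                      ]′ (good? (4 + n))

  -- Two consecutive good indices force doubling forever.

  module Doubling (m : ℕ) (good₀ : Good (2 + m)) (good₁ : Good (3 + m)) where

    private
      c = γ (3 + m)
      P = count (2 + m)

      0<c : 0 < c
      0<c = ≤-<-trans z≤n (γ-< m)

      instance
        c≢0 : NonZero c
        c≢0 = >-nonZero 0<c

      support : ∀ t → P (c + (c + t)) ≡ 0
      support = count-2*width (2 + m) c (proj₁ good₀)

    open Periodization P c support

    record Inv (i : ℕ) : Set where
      field
        γ≡     : γ (3 + (i + m)) ≡ 2 ^ i * c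
        count≡ : ∀ t → count (2 + (i + m)) t ≡ comb (2 ^ i) t
        width≤ : width (2 + (i + m)) ≤ 2 * γ (3 + (i + m))

      -- The new term is `2 ^ i * c`, so translating the first `2 ^ i` copies of `P` by it supplies
      -- exactly the next `2 ^ i`.
      next-count≡ : ∀ t → count (3 + (i + m)) t ≡ comb (2 ^ suc i) t
      next-count≡ t = begin
        count (3 + (i + m)) t
          ≡⟨ cong₂ _+_ (count≡ t) (trans (cong (λ d → shift d (count (2 + (i + m))) t) γ≡)
                                         (shift-cong (2 ^ i * c) count≡ t)) ⟩
        comb (2 ^ i) t + shift (2 ^ i * c) (comb (2 ^ i)) t
          ≡⟨ comb-+ (2 ^ i) (2 ^ i) t ⟨
        comb (2 ^ i + 2 ^ i) t
          ≡⟨ cong (λ K → comb (2 ^ i + K) t) (+-identityʳ (2 ^ i)) ⟨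
        comb (2 ^ suc i) t ∎
        where open ≡-Reasoning

    inv-step : ∀ {i} → Inv i → γ (4 + (i + m)) ≡ 2 * γ (3 + (i + m)) → Inv (suc i)
    inv-step {i} inv double = record
      { γ≡     = trans double (trans (cong (2 *_) γ≡) (sym (*-assoc 2 (2 ^ i) c)))
      ; count≡ = next-count≡
      ; width≤ = begin
          width (2 + (i + m)) + d   ≤⟨ +-monoˡ-≤ d width≤ ⟩
          2 * d + d                 ≤⟨ +-monoʳ-≤ (2 * d) (m≤m+n d (d + 0)) ⟩
          2 * d + 2 * d             ≡⟨ lemma d ⟩
          2 * (2 * d)               ≡⟨ cong (2 *_) double ⟨
          2 * γ (4 + (i + m))       ∎
      }
      where
      open Inv inv
      open ≤-Reasoning
      d = γ (3 + (i + m))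
      lemma : ∀ d → 2 * d + 2 * d ≡ 2 * (2 * d)
      lemma = solve-∀

    inv₀ : Inv 0
    inv₀ = record
      { γ≡     = sym (+-identityʳ c)
      ; count≡ = λ t → sym (trans (cong (λ z → P t + z) (shift-zero c t)) (+-identityʳ (P t)))
      ; width≤ = proj₁ good₀
      }
      where
      shift-zero : ∀ d t → shift d (λ _ → 0) t ≡ 0
      shift-zero zero    t       = refl
      shift-zero (suc d) zero    = refl
      shift-zero (suc d) (suc t) = shift-zero d t

    inv₁ : Inv 1
    inv₁ = inv-step inv₀ (good⇒doubles m good₀)

    inv₂ : Inv 2
    inv₂ = inv-step inv₁ (good⇒doubles (1 + m) good₁)

    -- By `inv₂`, `comb 4` is the count at the moment when `4 * c` was chosen.
    reduced-fits : ∀ n K s → (∀ t → count n t ≡ comb K t) → Fits n s →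
                   s + 2 * c ≤ K * c → Fits (4 + m) (reduced s)
    reduced-fits n K s n≡ fits s≤ t =
      subst₂ (λ x y → x + y ≤ g) (sym (Inv.count≡ inv₂ (reduced s + t))) (sym (Inv.count≡ inv₂ t))
        (comb-reduced K 4 (λ u → subst₂ (λ x y → x + y ≤ g) (n≡ (s + u)) (n≡ u) (fits u)) s≤ t)

    -- `reduced s` lies strictly between `γ (4 + m)`, which is `2 * c`, and the greedy choice
    -- `4 * c`, so it would have been preferred.
    ¬reduced-fits : ∀ s → ¬ Fits (4 + m) (reduced s)
    ¬reduced-fits s fits = <-irrefl refl (begin-strict
      4 * c       ≡⟨ Inv.γ≡ inv₂ ⟨
      γ (5 + m)   ≤⟨ γ-least (2 + m) above-2c fits ⟩
      reduced s   <⟨ +-monoˡ-< (3 * c) (m%n<n s c) ⟩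
      4 * c       ∎)
      where
      open ≤-Reasoning
      above-2c : γ (4 + m) < reduced s
      above-2c = begin-strict
        γ (4 + m)   ≡⟨ Inv.γ≡ inv₁ ⟩
        2 * c       <⟨ m<n+m (2 * c) 0<c ⟩
        3 * c       ≤⟨ m≤n+m (3 * c) (s % c) ⟩
        reduced s   ∎

    later-leaps : ∀ j → Inv (1 + j) → Inv (2 + j) → Leaps (4 + (j + m))
    later-leaps j inv inv′ = decidable-stable (_ <? _) λ ¬leaps →
      ¬reduced-fits (γ (6 + (j + m)))
        (reduced-fits (5 + (j + m)) (2 ^ (3 + j)) (γ (6 + (j + m)))
          (Inv.next-count≡ inv′) (γ-fits (3 + (j + m))) (room ¬leaps))
      where
      open ≤-Reasoning
      p = 2 ^ j
      lemma : ∀ p c → 2 * p * c + 2 * (2 * p) * c + 2 * (p * c) ≡ 2 * (2 * (2 * p)) * c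
      lemma = solve-∀
      room : ¬ Leaps (4 + (j + m)) → γ (6 + (j + m)) + 2 * c ≤ 2 ^ (3 + j) * c
      room ¬leaps = begin
        γ (6 + (j + m)) + 2 * c
          -- The two earlier terms are 2 p c and 4 p c; the remaining 2 p c out of 8 p c covers
          -- `2 * c` because `p` is positive.
          ≤⟨ +-mono-≤ (≮⇒≥ ¬leaps) (*-monoʳ-≤ 2 (m≤n*m c p {{m^n≢0 2 j}})) ⟩
        γ (4 + (j + m)) + γ (5 + (j + m)) + 2 * (p * c)
          ≡⟨ cong (λ z → z + 2 * (p * c)) (cong₂ _+_ (Inv.γ≡ inv) (Inv.γ≡ inv′)) ⟩
        2 * p * c + 2 * (2 * p) * c + 2 * (p * c)
          ≡⟨ lemma p c ⟩
        2 ^ (3 + j) * c ∎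

    mutual
      inv : ∀ i → Inv i
      inv zero    = inv₀
      inv (suc i) = inv-step (inv i) (doubles i)

      doubles : ∀ i → γ (4 + (i + m)) ≡ 2 * γ (3 + (i + m))
      doubles zero          = good⇒doubles m good₀
      doubles (suc zero)    = good⇒doubles (1 + m) good₁
      -- From here on goodness is derived: the width bound is carried by `Inv`, and the leap follows
      -- from the doublings already known.
      doubles (suc (suc j)) = good⇒doubles (2 + (j + m))
        (Inv.width≤ (inv (suc (suc j))) , later-leaps j (inv (suc j)) (inv (suc (suc j))))

  -- The explicit threshold.

  initial-potential : 8 * g * width 3 ≤ 2 ^ 3 * (2 * g * width 2)
  initial-potential = begin
    8 * g * (width 2 + γ 3)     ≤⟨ *-monoʳ-≤ (8 * g) (+-monoʳ-≤ (width 2) (γ≤width 0)) ⟩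
    8 * g * (width 2 + width 2) ≡⟨ lemma g (width 2) ⟩
    8 * (2 * g * width 2)       ∎
    where
    open ≤-Reasoning
    lemma : ∀ g w → 8 * g * (w + w) ≡ 8 * (2 * g * w)
    lemma = solve-∀

  -- The search starts with budget `2 * g * width 2`, where `width 2` is `1 + a + b`, and finds `m`
  -- within three times that. `Doubling` is entered at `1 + m`, so its first doubled term has index
  -- `5 + m`.
  doubles-from : ∀ n → 5 + 6 * g * (1 + a + b) ≤ n → γ n ≡ 2 * γ (n ∸ 1)
  doubles-from n n₀≤n =
    let (m , m≤ , good₀ , good₁) = good-pair (2 * g * width 2) 0 initial-potential in
    subst (λ k → γ k ≡ 2 * γ (k ∸ 1)) (n≡ m m≤)
      (Doubling.doubles (1 + m) good₀ good₁ (n ∸ (5 + m)))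
    where
    open ≤-Reasoning
    5+m≤n : ∀ m → m ≤ 3 * (2 * g * width 2) → 5 + m ≤ n
    5+m≤n m m≤ = begin
      5 + m                             ≤⟨ +-monoʳ-≤ 5 m≤ ⟩
      5 + 3 * (2 * g * width 2)         ≡⟨ cong₂ (λ x y → 5 + 3 * (2 * g * (1 + x + y))) first second ⟩
      5 + 3 * (2 * g * (1 + a + b))     ≡⟨ cong (λ z → 5 + z) (regroup g (1 + a + b)) ⟩
      5 + 6 * g * (1 + a + b)           ≤⟨ n₀≤n ⟩
      n                                 ∎
      where
      regroup : ∀ g w → 3 * (2 * g * w) ≡ 6 * g * w
      regroup = solve-∀
    lemma : ∀ k m → 4 + (k + (1 + m)) ≡ k + (5 + m)
    lemma = solve-∀
    n≡ : ∀ m → m ≤ 3 * (2 * g * width 2) → 4 + (n ∸ (5 + m) + (1 + m)) ≡ n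
    n≡ m m≤ = trans (lemma (n ∸ (5 + m)) m) (m∸n+n≡m (5+m≤n m m≤))

theorem5 : (g a b : ℕ) → 1 ≤ g → 0 < a → a < b →
    ∃[ n₀ ] ((γ : ℕ → ℕ) → IsGreedy g a b γ →
    (n : ℕ) → n₀ ≤ n → γ n ≡ 2 * γ (n ∸ 1))
theorem5 g a b 1≤g 0<a a<b = 5 + 6 * g * (1 + a + b) , λ γ greedy n n₀≤n →
  Greedy.doubles-from 1≤g 0<a a<b greedy n n₀≤n
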